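{- Let $d$ be a positive integer that is not a perfect square and let $z$ be an integer. Then: 1. $Q_{2^n}(d,z)$, $n\ge 0$, are the Newton approximations of $\sqrt d$ with initial condition $z$; that is, $Q_{2^n}(d,z)=x_n$ for every $n\ge0$, where $x_0=z$ and $x_n=\dfrac{x_{n-1}^2+d}{2x_{n-1}}$ for $n\ge1$. 2. For every $n\ge0$, $Q_{2n+1}(d,z)$ is the Padé approximation of $\sqrt d$ centered in $z^2$ and of degree $n$, where $Q_{2n+1}(d,z)$ and $\sqrt d$ are regarded as functions of the variable $d$ with $z$ fixed.
   Context: For an integer $z$, set $N_n(d,z)=\sum_{i\ge 0}\binom{n}{2i}d^iz^{n-2i}$ and $D_n(d,z)=\sum_{i\ge 0}\binom{n}{2i+1}d^iz^{n-2i-1}$ (terms with zero binomial coefficient are omitted), so that $(z+\sqrt d)^n=N_n(d,z)+D_n(d,z)\sqrt d$. These are polynomials in $d$ for fixed $z$. The Rédei rational functions are $Q_n(d,z)=N_n(d,z)/D_n(d,z)$ for $n\ge1$. The Newton approximations of $\sqrt d$ are the iterates of Newton's method applied to $f(x)=x^2-d$. The Padé approximation of degree $n$ of a function $f$ centered in $c$ is the ratio $P/R$ of polynomials $P,R$ of degree at most $n$, with $R(c)\ne0$, such that the Taylor series of $f-P/R$ at $c$ has only terms of order at least $2n+1$.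
   Formalization: In part 2, z = 0 is excluded (√d has no Taylor series at 0), and for z < 0 the symbol √d means the branch with value z at d = z², since with the positive root the claim fails (z = -1, n = 0: Q_1 = -1 but √1 = 1). -}

module Defs where

open import Algebra.Definitions.RawSemiring using (_^_)
open import Data.Integer.Base as ℤ using (ℤ; +_; -[1+_]; +[1+_])
open import Data.List.Base using (List; []; _∷_; applyUpTo)
open import Data.Maybe.Base using (Maybe; just; nothing; _>>=_)
open import Data.Nat.Base as ℕ using (ℕ; zero; suc; ⌊_/2⌋; ⌈_/2⌉; _!)
open import Data.Nat.Combinatorics using (_C_)
open import Data.Nat.Coprimality as Coprimality using (1-coprimeTo)
open import Data.Nat.GeneralisedArithmetic using (fold)
open import Data.Nat.Properties using (_!≢0)
open import Data.Rational.Base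
  using (ℚ; mkℚ; 0ℚ; _+_; _*_; _-_; _/_; _÷_; 1/_; NonZero; ≢-nonZero; +-*-rawSemiring)
open import Data.Rational.Properties using (_≟_; *-identityʳ)
open import Relation.Binary.PropositionalEquality using (_≡_; _≢_; sym; trans)
open import Relation.Nullary.Decidable.Core using (yes; no)

fromℤ : ℤ → ℚ
fromℤ z = mkℚ z 0 (Coprimality.sym (1-coprimeTo ℤ.∣ z ∣))

fromℤ-nonZero : ∀ z → .{{ℤ.NonZero z}} → NonZero (fromℤ z)
fromℤ-nonZero +[1+ _ ] = _
fromℤ-nonZero -[1+ _ ] = _

infixl 7 _/?_

_/?_ : ℚ → ℚ → Maybe ℚ
p /? q with q ≟ 0ℚ
... | yes _   = nothing
... | no  q≢0 = just ((p ÷ q) {{≢-nonZero q≢0}})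

-- Coefficient lists over ℚ, constant term first; trailing zeros are allowed.

Poly : Set
Poly = List ℚ

coeff : Poly → ℕ → ℚ
coeff []      _       = 0ℚ
coeff (a ∷ _) zero    = a
coeff (_ ∷ p) (suc k) = coeff p k

Degree≤ : ℕ → Poly → Set
Degree≤ n p = ∀ k → n ℕ.< k → coeff p k ≡ 0ℚ

eval : Poly → ℚ → ℚ
eval []      _ = 0ℚ
eval (a ∷ p) x = a + x * eval p x

-- weight j (a₀ ∷ a₁ ∷ …) = j a₀ ∷ (j + 1) a₁ ∷ …
weight : ℕ → Poly → Poly
weight _ []      = []
weight j (a ∷ p) = fromℤ (+ j) * a ∷ weight (suc j) p

deriv : Poly → Poly
deriv []      = []
deriv (_ ∷ p) = weight 1 p

record Ratio : Set where
  constructor _//_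
  field
    num den : Poly

open Ratio public

evalRatio : Ratio → ℚ → Maybe ℚ
evalRatio (p // r) x = eval p x /? eval r x

-- N m z, D m z and Q m z are polynomials, respectively a rational function, in
-- the variable d.  The ranges are exactly 2i ≤ m and 2i + 1 ≤ m, so the
-- truncated subtractions are never proper.

N : ℕ → ℤ → Poly
N m z = applyUpTo (λ i → fromℤ (+ (m C (2 ℕ.* i)) ℤ.* z ℤ.^ (m ℕ.∸ 2 ℕ.* i)))
                  (suc ⌊ m /2⌋)

D : ℕ → ℤ → Poly
D m z = applyUpTo (λ i → fromℤ (+ (m C (2 ℕ.* i ℕ.+ 1)) ℤ.* z ℤ.^ (m ℕ.∸ (2 ℕ.* i ℕ.+ 1))))
                  ⌈ m /2⌉

Q : ℕ → ℤ → Ratio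
Q m z = N m z // D m z

-- `nothing` from the first division by zero on.
newton : ℕ → ℤ → ℕ → Maybe ℚ
newton d z zero    = just (fromℤ z)
newton d z (suc n) =
  newton d z n >>= λ x → (x * x + fromℤ (+ d)) /? (fromℤ (+ 2) * x)

-- The series s stands for Σₖ s k · (x - c)ᵏ, the centre c being given by context.

Series : Set
Series = ℕ → ℚ

-- The coefficients f⁽ᵏ⁾(c) / k!, for a class F of functions with derivation ∂
-- and evaluation ev at c.
taylor : {F : Set} (∂ : F → F) (ev : F → ℚ) → F → Series
taylor ∂ ev f k = ev (fold f ∂ k) * ((+ 1 / k !) {{k !≢0}})

polyTaylor : ℚ → Poly → Series
polyTaylor c = taylor deriv (λ p → eval p c)

polyTaylor-nonZero : ∀ c p → eval p c ≢ 0ℚ → NonZero (polyTaylor c p 0)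
polyTaylor-nonZero c p p≢0 = ≢-nonZero λ e → p≢0 (trans (sym (*-identityʳ _)) e)

-- Quotient of power series by long division: with q₀ = p₀ / r₀, the remaining
-- coefficients are those of the quotient of (p - q₀ r) / (x - c) by r.
quot : (p r : Series) → .{{NonZero (r 0)}} → Series
quot p r zero    = p 0 ÷ r 0
quot p r (suc k) = quot (λ i → p (suc i) - (p 0 ÷ r 0) * r (suc i)) r k

infixr 8 _^ᶻ_

_^ᶻ_ : (r : ℚ) → .{{NonZero r}} → ℤ → ℚ
r ^ᶻ (+ n)    = _^_ +-*-rawSemiring r n
r ^ᶻ -[1+ n ] = _^_ +-*-rawSemiring (1/ r) (suc n)

-- a ·x^ m /2 is the function a x^(m/2).
record HalfPower : Set where
  constructor _·x^_/2
  field
    factor : ℚ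
    twice  : ℤ

derivHalf : HalfPower → HalfPower
derivHalf (a ·x^ m /2) = (a * (m / 2)) ·x^ (m ℤ.- + 2) /2

-- The value at x = r², for the branch of √x with √(r²) = r.
evalHalf : (r : ℚ) → .{{NonZero r}} → HalfPower → ℚ
evalHalf r (a ·x^ m /2) = a * r ^ᶻ m

-- The Taylor series at r² of the branch of √x that takes the value r there;
-- for r > 0 this is the positive square root.
√-taylor : (r : ℚ) → .{{NonZero r}} → Series
√-taylor r = taylor derivHalf (evalHalf r) (fromℤ (+ 1) ·x^ + 1 /2)

-- g is the Padé approximation of degree n, centred at c, of a function whose
-- Taylor series at c is f.
record IsPadé (n : ℕ) (c : ℚ) (f : Series) (g : Ratio) : Set where
  field
    num-degree : Degree≤ n (num g)
    den-degree : Degree≤ n (den g)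
    den≢0      : eval (den g) c ≢ 0ℚ

  ratioTaylor : Series
  ratioTaylor = quot (polyTaylor c (num g)) (polyTaylor c (den g))
                     {{polyTaylor-nonZero c (den g) den≢0}}

  field
    vanish : ∀ k → k ℕ.< 2 ℕ.* n ℕ.+ 1 → f k - ratioTaylor k ≡ 0ℚ

{-# OPTIONS --safe #-}
module Submission where

-- Part 1: from (z + √d)²ᵐ = ((z + √d)ᵐ)² one gets N₂ₘ = Nₘ² + d Dₘ² and
-- D₂ₘ = 2 Nₘ Dₘ, so passing from m to 2m is a Newton step x ↦ (x² + d)/(2x) on
-- x = Nₘ/Dₘ.
--
-- Part 2: write x = c + t with c = z², and let s be the Taylor series of √x at c,
-- so that s² = c + t.  The recurrences for N and D give Nₘ − s Dₘ = (z − s)ᵐ as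
-- power series in t.  As s has constant term z, this is divisible by tᵐ, while
-- Dₘ(c) ≠ 0; for m = 2n + 1 this is the Padé condition.

open import Defs
open import Algebra.Properties.CommutativeSemigroup using (x∙yz≈y∙xz)
open import Data.Empty using (⊥)
open import Data.Integer.Base as ℤ using (ℤ; +_)
import Data.Integer.Properties as ℤ
open import Data.List.Base using ([]; _∷_; applyUpTo; map)
open import Data.Maybe using (Is-just)
open import Data.Maybe.Base using (just; nothing; _>>=_)
open import Data.Maybe.Relation.Unary.Any using (just)
open import Data.Nat.Base as ℕ using (ℕ; zero; suc; ⌊_/2⌋; ⌈_/2⌉; _!; s≤s; z≤n)
open import Data.Nat.Combinatorics
  using (_C_; nCn≡1; nCk≡nC[n∸k]; k>n⇒nCk≡0; nCk+nC[k+1]≡[n+1]C[k+1])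
open import Data.Nat.GeneralisedArithmetic using (fold)
import Data.Nat.Properties as ℕ
open import Data.Product.Base using (∃; _×_; _,_; proj₁; proj₂)
open import Data.Rational.Base as ℚ
  using (ℚ; 0ℚ; 1ℚ; _/_; _÷_; 1/_; _+_; _*_; _-_; -_)
import Data.Rational.Properties as ℚ
open import Data.Rational.Solver using (module +-*-Solver)
import Data.Rational.Unnormalised.Base as ℚᵘ
import Data.Rational.Unnormalised.Properties as ℚᵘ
open import Data.Sum.Base using (inj₁; inj₂)
open import Data.Unit.Base using (tt)
open import Function.Base using (_∘_)
open import Relation.Binary.PropositionalEquality
open import Relation.Nullary.Decidable.Core using (yes; no)
open import Relation.Nullary.Negation.Core using (¬_; contradiction)
open +-*-Solver using (solve; _:=_; _:+_; _:*_; _:-_; :-_; con)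
open ≡-Reasoning

-- The series s is given by iterated formal derivatives of x^(1/2), not as a solution of s² = x, so
-- s² = c + t has to be derived. The derivatives yield 2 x s′ = s, hence x y′ = y for y = s²; as c ≠
-- 0, comparing coefficients together with y(0) = c determines y completely.
--
-- The Taylor series of a ratio is defined by long division, so it is never computed: a series whose
-- product with the denominator agrees with the numerator below some order agrees with the quotient
-- below that order.
--
-- Part 1 equates partial values, so every division has to be accounted for. For z ≠ 0, positivity
-- of d keeps all numerators and denominators away from zero; for z = 0, both sides are undefined
-- from n = 1 on.

-- Arithmetic and division in ℚ

fromℤ-homo-+ : ∀ i j → fromℤ (i ℤ.+ j) ≡ fromℤ i + fromℤ j
fromℤ-homo-+ i j = ℚ.toℚᵘ-injective (ℚᵘ.≃-trans
  (ℚᵘ.*≡* (cong (ℤ._* + 1) (cong₂ ℤ._+_ (sym (ℤ.*-identityʳ i)) (sym (ℤ.*-identityʳ j)))))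
  (ℚᵘ.≃-sym (ℚ.toℚᵘ-homo-+ (fromℤ i) (fromℤ j))))

fromℤ-homo-* : ∀ i j → fromℤ (i ℤ.* j) ≡ fromℤ i * fromℤ j
fromℤ-homo-* i j = ℚ.toℚᵘ-injective (ℚᵘ.≃-trans
  (ℚᵘ.*≡* refl) (ℚᵘ.≃-sym (ℚ.toℚᵘ-homo-* (fromℤ i) (fromℤ j))))

-- `_/_` reduces to lowest terms, so the identity is checked on unnormalised fractions, where it is
-- cross-multiplication.
/-*-cancel : ∀ i n .{{_ : ℕ.NonZero n}} → (i / n) * fromℤ (+ n) ≡ fromℤ i
/-*-cancel i n@(suc n-1) = ℚ.toℚᵘ-injective (ℚᵘ.≃-trans
  (ℚ.toℚᵘ-homo-* (i / n) (fromℤ (+ n)))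
  (ℚᵘ.≃-trans (ℚᵘ.*-congʳ {ℚᵘ.mkℚᵘ (+ n) 0} (ℚ.toℚᵘ-fromℚᵘ (ℚᵘ.mkℚᵘ i n-1)))
    (ℚᵘ.*≡* (trans (ℤ.*-identityʳ _) (cong (λ k → i ℤ.* + k) (sym (ℕ.*-identityʳ n)))))))

fromℤ≢0 : ∀ {i} → i ≢ + 0 → fromℤ i ≢ 0ℚ
fromℤ≢0 i≢0 e = i≢0 (cong ℚ.numerator e)

two : ℚ
two = fromℤ (+ 2)

*-cancelʳ : ∀ {p q} r → r ≢ 0ℚ → p * r ≡ q * r → p ≡ q
*-cancelʳ {p} {q} r r≢0 pr≡qr = begin
  p               ≡⟨ insert p ⟩
  p * r * (1/ r)  ≡⟨ cong (_* (1/ r)) pr≡qr ⟩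
  q * r * (1/ r)  ≡⟨ insert q ⟨
  q               ∎
  where
  instance r-nonZero = ℚ.≢-nonZero r≢0
  insert : ∀ x → x ≡ x * r * (1/ r)
  insert x = begin
    x                 ≡⟨ ℚ.*-identityʳ x ⟨
    x * 1ℚ            ≡⟨ cong (x *_) (ℚ.*-inverseʳ r) ⟨
    x * (r * (1/ r))  ≡⟨ ℚ.*-assoc x r (1/ r) ⟨
    x * r * (1/ r)    ∎

÷-* : ∀ p q .{{_ : ℚ.NonZero q}} → (p ÷ q) * q ≡ p
÷-* p q = begin
  p * (1/ q) * q    ≡⟨ ℚ.*-assoc p (1/ q) q ⟩
  p * ((1/ q) * q)  ≡⟨ cong (p *_) (ℚ.*-inverseˡ q) ⟩
  p * 1ℚ            ≡⟨ ℚ.*-identityʳ p ⟩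
  p                 ∎

nonZero⇒≢0 : ∀ q → .{{ℚ.NonZero q}} → q ≢ 0ℚ
-- The instance is irrelevant, so it can only be refuted by a function that takes it irrelevantly.
nonZero⇒≢0 q {{q≢0}} refl = absurd q≢0
  where
  absurd : .(ℚ.NonZero 0ℚ) → ⊥
  absurd ()

÷-unique : ∀ {p w} q .{{_ : ℚ.NonZero q}} → w * q ≡ p → p ÷ q ≡ w
÷-unique {p} q wq≡p = *-cancelʳ q (nonZero⇒≢0 q) (trans (÷-* p q) (sym wq≡p))

/?-unique : ∀ {p w} q → q ≢ 0ℚ → w * q ≡ p → p /? q ≡ just w
/?-unique q q≢0 wq≡p with q ℚ.≟ 0ℚ
... | yes q≡0  = contradiction q≡0 q≢0
... | no  q≢0′ = cong just (÷-unique q {{ℚ.≢-nonZero q≢0′}} wq≡p)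

*≢0 : ∀ {p q} → p ≢ 0ℚ → q ≢ 0ℚ → p * q ≢ 0ℚ
*≢0 {p} {q} p≢0 q≢0 pq≡0 = p≢0 (*-cancelʳ q q≢0 (trans pq≡0 (sym (ℚ.*-zeroˡ q))))

0≤p*p : ∀ p → 0ℚ ℚ.≤ p * p
0≤p*p p with ℚ.≤-total 0ℚ p
... | inj₁ 0≤p = ℚ.nonNegative⁻¹ (p * p)
  {{ℚ.nonNeg*nonNeg⇒nonNeg p {{ℚ.nonNegative 0≤p}} p {{ℚ.nonNegative 0≤p}}}}
... | inj₂ p≤0 = ℚ.nonNegative⁻¹ (p * p)
  {{ℚ.nonPos*nonPos⇒nonPos p {{ℚ.nonPositive p≤0}} p {{ℚ.nonPositive p≤0}}}}

-- Polynomials up to trailing zeros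

infix 4 _≈_
-- Equality of lists is too fine: in `derivs-shift` with `p` empty, one side is empty and the other
-- is a list of zeros.
_≈_ : Poly → Poly → Set
p ≈ q = ∀ k → coeff p k ≡ coeff q k

infixl 6 _⊕_
_⊕_ : Poly → Poly → Poly
[]      ⊕ q       = q
(a ∷ p) ⊕ []      = a ∷ p
(a ∷ p) ⊕ (b ∷ q) = a + b ∷ p ⊕ q

infixr 7 _·_
_·_ : ℚ → Poly → Poly
a · p = map (a *_) p

shift : Poly → Poly
shift p = 0ℚ ∷ p

coeff-⊕ : ∀ p q k → coeff (p ⊕ q) k ≡ coeff p k + coeff q k
coeff-⊕ []      q       k       = sym (ℚ.+-identityˡ _)
coeff-⊕ (a ∷ p) []      k       = sym (ℚ.+-identityʳ _)
coeff-⊕ (a ∷ p) (b ∷ q) zero    = refl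
coeff-⊕ (a ∷ p) (b ∷ q) (suc k) = coeff-⊕ p q k

coeff-· : ∀ a p k → coeff (a · p) k ≡ a * coeff p k
coeff-· a []      k       = sym (ℚ.*-zeroʳ a)
coeff-· a (b ∷ p) zero    = refl
coeff-· a (b ∷ p) (suc k) = coeff-· a p k

coeff-weight : ∀ j p k → coeff (weight j p) k ≡ fromℤ (+ (k ℕ.+ j)) * coeff p k
coeff-weight j []      k       = sym (ℚ.*-zeroʳ (fromℤ (+ (k ℕ.+ j))))
coeff-weight j (a ∷ p) zero    = refl
coeff-weight j (a ∷ p) (suc k) = trans (coeff-weight (suc j) p k)
  (cong (λ i → fromℤ (+ i) * coeff p k) (ℕ.+-suc k j))

coeff-deriv : ∀ p k → coeff (deriv p) k ≡ fromℤ (+ suc k) * coeff p (suc k)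
coeff-deriv []      k = sym (ℚ.*-zeroʳ (fromℤ (+ suc k)))
coeff-deriv (a ∷ p) k = trans (coeff-weight 1 p k)
  (cong (λ i → fromℤ (+ i) * coeff p k) (ℕ.+-comm k 1))

deriv-cong : ∀ p q → p ≈ q → deriv p ≈ deriv q
deriv-cong p q p≈q k = begin
  coeff (deriv p) k                    ≡⟨ coeff-deriv p k ⟩
  fromℤ (+ suc k) * coeff p (suc k)    ≡⟨ cong (fromℤ (+ suc k) *_) (p≈q (suc k)) ⟩
  fromℤ (+ suc k) * coeff q (suc k)    ≡⟨ coeff-deriv q k ⟨
  coeff (deriv q) k                    ∎

deriv-⊕ : ∀ p q → deriv (p ⊕ q) ≈ deriv p ⊕ deriv q
deriv-⊕ p q k = begin
  coeff (deriv (p ⊕ q)) k                                ≡⟨ coeff-deriv (p ⊕ q) k ⟩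
  n * coeff (p ⊕ q) (suc k)                              ≡⟨ cong (n *_) (coeff-⊕ p q (suc k)) ⟩
  n * (coeff p (suc k) + coeff q (suc k))
    ≡⟨ ℚ.*-distribˡ-+ n (coeff p (suc k)) (coeff q (suc k)) ⟩
  n * coeff p (suc k) + n * coeff q (suc k)
    ≡⟨ cong₂ _+_ (coeff-deriv p k) (coeff-deriv q k) ⟨
  coeff (deriv p) k + coeff (deriv q) k                  ≡⟨ coeff-⊕ (deriv p) (deriv q) k ⟨
  coeff (deriv p ⊕ deriv q) k                            ∎
  where n = fromℤ (+ suc k)

deriv-· : ∀ a p → deriv (a · p) ≈ a · deriv p
deriv-· a p k = begin
  coeff (deriv (a · p)) k        ≡⟨ coeff-deriv (a · p) k ⟩
  n * coeff (a · p) (suc k)      ≡⟨ cong (n *_) (coeff-· a p (suc k)) ⟩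
  n * (a * coeff p (suc k))      ≡⟨ solve 3 (λ n a x → n :* (a :* x) := a :* (n :* x)) refl n a _ ⟩
  a * (n * coeff p (suc k))      ≡⟨ cong (a *_) (coeff-deriv p k) ⟨
  a * coeff (deriv p) k          ≡⟨ coeff-· a (deriv p) k ⟨
  coeff (a · deriv p) k          ∎
  where n = fromℤ (+ suc k)

eval-zero : ∀ p x → p ≈ [] → eval p x ≡ 0ℚ
eval-zero []      x p≈0 = refl
eval-zero (a ∷ p) x p≈0 = begin
  a + x * eval p x  ≡⟨ cong₂ (λ u v → u + x * v) (p≈0 0) (eval-zero p x (p≈0 ∘ suc)) ⟩
  0ℚ + x * 0ℚ       ≡⟨ solve 1 (λ x → con 0ℚ :+ x :* con 0ℚ := con 0ℚ) refl x ⟩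
  0ℚ                ∎

eval-cong : ∀ p q x → p ≈ q → eval p x ≡ eval q x
eval-cong []      q       x p≈q = sym (eval-zero q x (sym ∘ p≈q))
eval-cong (a ∷ p) []      x p≈q = eval-zero (a ∷ p) x p≈q
eval-cong (a ∷ p) (b ∷ q) x p≈q = cong₂ (λ u v → u + x * v) (p≈q 0) (eval-cong p q x (p≈q ∘ suc))

eval-⊕ : ∀ p q x → eval (p ⊕ q) x ≡ eval p x + eval q x
eval-⊕ []      q       x = sym (ℚ.+-identityˡ _)
eval-⊕ (a ∷ p) []      x = sym (ℚ.+-identityʳ _)
eval-⊕ (a ∷ p) (b ∷ q) x = trans (cong (λ u → a + b + x * u) (eval-⊕ p q x))
  (solve 5 (λ a b x u v → a :+ b :+ x :* (u :+ v) := a :+ x :* u :+ (b :+ x :* v)) refl a b x _ _)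

eval-· : ∀ a p x → eval (a · p) x ≡ a * eval p x
eval-· a []      x = sym (ℚ.*-zeroʳ a)
eval-· a (b ∷ p) x = trans (cong (λ u → a * b + x * u) (eval-· a p x))
  (solve 4 (λ a b x u → a :* b :+ x :* (a :* u) := a :* (b :+ x :* u)) refl a b x _)

eval-shift : ∀ p x → eval (shift p) x ≡ x * eval p x
eval-shift p x = ℚ.+-identityˡ _

-- Taylor series of polynomials

derivs : ℕ → Poly → Poly
derivs k p = fold p deriv k

derivs-cong : ∀ k p q → p ≈ q → derivs k p ≈ derivs k q
derivs-cong zero    p q p≈q = p≈q
derivs-cong (suc k) p q p≈q = deriv-cong (derivs k p) (derivs k q) (derivs-cong k p q p≈q)

derivs-⊕ : ∀ k p q → derivs k (p ⊕ q) ≈ derivs k p ⊕ derivs k q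
derivs-⊕ zero    p q i = refl
derivs-⊕ (suc k) p q i = trans (deriv-cong (derivs k (p ⊕ q)) (derivs k p ⊕ derivs k q) (derivs-⊕ k p q) i)
  (deriv-⊕ (derivs k p) (derivs k q) i)

derivs-· : ∀ k a p → derivs k (a · p) ≈ a · derivs k p
derivs-· zero    a p i = refl
derivs-· (suc k) a p i = trans (deriv-cong (derivs k (a · p)) (a · derivs k p) (derivs-· k a p) i)
  (deriv-· a (derivs k p) i)

-- Both sides are multiples of coefficient `i + k` of `p`: the falling factorial from
-- differentiating `shift p` has one more factor than the one for `p`.
coeff-derivs-shift : ∀ k p i →
  coeff (derivs (suc k) (shift p)) i ≡ fromℤ (+ suc (i ℕ.+ k)) * coeff (derivs k p) i
coeff-derivs-shift zero    p i = trans (coeff-deriv (shift p) i)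
  (cong (λ j → fromℤ (+ suc j) * coeff p i) (sym (ℕ.+-identityʳ i)))
coeff-derivs-shift (suc k) p i = begin
  coeff (derivs (suc (suc k)) (shift p)) i             ≡⟨ coeff-deriv (derivs (suc k) (shift p)) i ⟩
  m * coeff (derivs (suc k) (shift p)) (suc i)
    ≡⟨ cong (m *_) (coeff-derivs-shift k p (suc i)) ⟩
  m * (n * coeff (derivs k p) (suc i))
    ≡⟨ solve 3 (λ m n u → m :* (n :* u) := n :* (m :* u)) refl m n (coeff (derivs k p) (suc i)) ⟩
  n * (m * coeff (derivs k p) (suc i))                 ≡⟨ cong (n *_) (coeff-deriv (derivs k p) i) ⟨
  n * coeff (derivs (suc k) p) i
    ≡⟨ cong (λ j → fromℤ (+ suc j) * coeff (derivs (suc k) p) i) (ℕ.+-suc i k) ⟨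
  fromℤ (+ suc (i ℕ.+ suc k)) * coeff (derivs (suc k) p) i ∎
  where
  m = fromℤ (+ suc i)
  n = fromℤ (+ suc (suc i ℕ.+ k))

coeff-shift-deriv : ∀ p i → coeff (shift (deriv p)) i ≡ fromℤ (+ i) * coeff p i
coeff-shift-deriv p zero    = sym (ℚ.*-zeroˡ (coeff p 0))
coeff-shift-deriv p (suc i) = coeff-deriv p i

-- Leibniz rule for a product with the variable. Coefficientwise the factor splits into `i` and
-- `suc k`, and multiplying coefficient `i` by `i` is the operator x d/dx.
derivs-shift : ∀ k p →
  derivs (suc k) (shift p) ≈ shift (derivs (suc k) p) ⊕ fromℤ (+ suc k) · derivs k p
derivs-shift k p i = begin
  coeff (derivs (suc k) (shift p)) i                   ≡⟨ coeff-derivs-shift k p i ⟩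
  fromℤ (+ suc (i ℕ.+ k)) * u
    ≡⟨ cong (λ j → fromℤ (+ j) * u) (ℕ.+-suc i k) ⟨
  fromℤ (+ (i ℕ.+ suc k)) * u
    ≡⟨ cong (λ j → fromℤ j * u) (ℤ.pos-+ i (suc k)) ⟩
  fromℤ (+ i ℤ.+ + suc k) * u
    ≡⟨ cong (_* u) (fromℤ-homo-+ (+ i) (+ suc k)) ⟩
  (fromℤ (+ i) + fromℤ (+ suc k)) * u
    ≡⟨ ℚ.*-distribʳ-+ u (fromℤ (+ i)) (fromℤ (+ suc k)) ⟩
  fromℤ (+ i) * u + fromℤ (+ suc k) * u
    ≡⟨ cong₂ _+_ (coeff-shift-deriv (derivs k p) i) (coeff-· (fromℤ (+ suc k)) (derivs k p) i) ⟨
  coeff (shift (derivs (suc k) p)) i + coeff (fromℤ (+ suc k) · derivs k p) i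
    ≡⟨ coeff-⊕ (shift (derivs (suc k) p)) (fromℤ (+ suc k) · derivs k p) i ⟨
  coeff (shift (derivs (suc k) p) ⊕ fromℤ (+ suc k) · derivs k p) i ∎
  where u = coeff (derivs k p) i

invFact : ℕ → ℚ
invFact k = (+ 1 / (k !)) {{ℕ._!≢0 k}}

invFact-suc : ∀ k → invFact (suc k) * fromℤ (+ suc k) ≡ invFact k
invFact-suc k = *-cancelʳ (fromℤ (+ (k !))) (fromℤ≢0 k!≢0) (begin
  invFact (suc k) * fromℤ (+ suc k) * fromℤ (+ (k !))    ≡⟨ ℚ.*-assoc (invFact (suc k)) _ _ ⟩
  invFact (suc k) * (fromℤ (+ suc k) * fromℤ (+ (k !)))
    ≡⟨ cong (invFact (suc k) *_) (fromℤ-homo-* (+ suc k) (+ (k !))) ⟨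
  invFact (suc k) * fromℤ (+ suc k ℤ.* + (k !))
    ≡⟨ cong (λ j → invFact (suc k) * fromℤ j) (ℤ.pos-* (suc k) (k !)) ⟨
  invFact (suc k) * fromℤ (+ (suc k !))
    ≡⟨ /-*-cancel (+ 1) (suc k !) {{ℕ._!≢0 (suc k)}} ⟩
  fromℤ (+ 1)                                            ≡⟨ /-*-cancel (+ 1) (k !) {{ℕ._!≢0 k}} ⟨
  invFact k * fromℤ (+ (k !))                            ∎)
  where
  k!≢0 : + (k !) ≢ + 0
  k!≢0 e = ℕ.≢-nonZero⁻¹ (k !) {{ℕ._!≢0 k}} (ℤ.+-injective e)

polyTaylor-cong : ∀ c p q → p ≈ q → ∀ k → polyTaylor c p k ≡ polyTaylor c q k
polyTaylor-cong c p q p≈q k =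
  cong (_* invFact k) (eval-cong (derivs k p) (derivs k q) c (derivs-cong k p q p≈q))

polyTaylor-⊕ : ∀ c p q k → polyTaylor c (p ⊕ q) k ≡ polyTaylor c p k + polyTaylor c q k
polyTaylor-⊕ c p q k = trans (cong (_* invFact k) (trans
  (eval-cong (derivs k (p ⊕ q)) (derivs k p ⊕ derivs k q) c (derivs-⊕ k p q))
  (eval-⊕ (derivs k p) (derivs k q) c)))
  (ℚ.*-distribʳ-+ (invFact k) (eval (derivs k p) c) (eval (derivs k q) c))

polyTaylor-· : ∀ c a p k → polyTaylor c (a · p) k ≡ a * polyTaylor c p k
polyTaylor-· c a p k = trans (cong (_* invFact k) (trans
  (eval-cong (derivs k (a · p)) (a · derivs k p) c (derivs-· k a p))
  (eval-· a (derivs k p) c))) (ℚ.*-assoc a _ _)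

-- The product with x = c + t.
mulx : ℚ → Series → Series
mulx c f zero    = c * f 0
mulx c f (suc k) = c * f (suc k) + f k

-- The Leibniz rule divided by (k + 1)!, where the factor k + 1 turns 1/(k + 1)! into 1/k!.
polyTaylor-shift : ∀ c p k → polyTaylor c (shift p) k ≡ mulx c (polyTaylor c p) k
polyTaylor-shift c p zero    = trans (cong (_* invFact 0) (eval-shift p c)) (ℚ.*-assoc c _ _)
polyTaylor-shift c p (suc k) = begin
  eval (derivs (suc k) (shift p)) c * i′
    ≡⟨ cong (_* i′) (eval-cong (derivs (suc k) (shift p)) (shift X′ ⊕ n · X) c (derivs-shift k p)) ⟩
  eval (shift X′ ⊕ n · X) c * i′
    ≡⟨ cong (_* i′) (eval-⊕ (shift X′) (n · X) c) ⟩
  (eval (shift X′) c + eval (n · X) c) * i′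
    ≡⟨ cong₂ (λ u v → (u + v) * i′) (eval-shift X′ c) (eval-· n X c) ⟩
  (c * eval X′ c + n * eval X c) * i′
    ≡⟨ solve 5 (λ c u n v i → (c :* u :+ n :* v) :* i := c :* (u :* i) :+ v :* (i :* n)) refl c (eval X′ c) n (eval X c) i′ ⟩
  c * (eval X′ c * i′) + eval X c * (i′ * n)
    ≡⟨ cong (λ u → c * (eval X′ c * i′) + eval X c * u) (invFact-suc k) ⟩
  c * (eval X′ c * i′) + eval X c * invFact k ∎
  where
  X = derivs k p
  X′ = derivs (suc k) p
  n = fromℤ (+ suc k)
  i′ = invFact (suc k)

-- The recurrences for N and D

-- The coefficient of wʲ in (z + w)ᵐ. With w² = x, the even `j` make up `N` and the odd ones `D`, so
-- Pascal's rule in `j` serves both.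
term : ℕ → ℤ → ℕ → ℚ
term m z j = fromℤ (+ (m C j) ℤ.* z ℤ.^ (m ℕ.∸ j))

nC0≡1 : ∀ n → n C 0 ≡ 1
nC0≡1 n = trans (nCk≡nC[n∸k] {0} {n} z≤n) (nCn≡1 n)

term-beyond : ∀ {m j} z → m ℕ.< j → term m z j ≡ 0ℚ
term-beyond {m} {j} z m<j = cong fromℤ (trans
  (cong (λ b → + b ℤ.* z ℤ.^ (m ℕ.∸ j)) (k>n⇒nCk≡0 m<j)) (ℤ.*-zeroˡ (z ℤ.^ (m ℕ.∸ j))))

term-suc-zero : ∀ m z → term (suc m) z 0 ≡ fromℤ z * term m z 0
term-suc-zero m z = begin
  fromℤ (+ (suc m C 0) ℤ.* (z ℤ.* z ℤ.^ m))
    ≡⟨ cong (λ b → fromℤ (+ b ℤ.* (z ℤ.* z ℤ.^ m))) (nC0≡1 (suc m)) ⟩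
  fromℤ (+ 1 ℤ.* (z ℤ.* z ℤ.^ m))
    ≡⟨ cong fromℤ (x∙yz≈y∙xz ℤ.*-commutativeSemigroup (+ 1) z (z ℤ.^ m)) ⟩
  fromℤ (z ℤ.* (+ 1 ℤ.* z ℤ.^ m))             ≡⟨ fromℤ-homo-* z _ ⟩
  fromℤ z * fromℤ (+ 1 ℤ.* z ℤ.^ m)
    ≡⟨ cong (λ b → fromℤ z * fromℤ (+ b ℤ.* z ℤ.^ m)) (nC0≡1 m) ⟨
  fromℤ z * term m z 0                        ∎

-- For m ≤ j the exponents do not differ, but then the binomial coefficient is zero.
term-lower : ∀ m z j → fromℤ (+ (m C suc j) ℤ.* z ℤ.^ (m ℕ.∸ j)) ≡ fromℤ z * term m z (suc j)
term-lower m z j with suc j ℕ.≤? m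
... | no  j≮m = begin
  fromℤ (+ (m C suc j) ℤ.* z ℤ.^ (m ℕ.∸ j))
    ≡⟨ cong (λ b → fromℤ (+ b ℤ.* z ℤ.^ (m ℕ.∸ j))) (k>n⇒nCk≡0 (ℕ.≰⇒> j≮m)) ⟩
  fromℤ (+ 0 ℤ.* z ℤ.^ (m ℕ.∸ j))             ≡⟨ cong fromℤ (ℤ.*-zeroˡ (z ℤ.^ (m ℕ.∸ j))) ⟩
  0ℚ                                          ≡⟨ ℚ.*-zeroʳ (fromℤ z) ⟨
  fromℤ z * 0ℚ                                ≡⟨ cong (fromℤ z *_) (term-beyond z (ℕ.≰⇒> j≮m)) ⟨
  fromℤ z * term m z (suc j)                  ∎
... | yes j<m = begin
  fromℤ (b ℤ.* z ℤ.^ (m ℕ.∸ j))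
    ≡⟨ cong (λ e → fromℤ (b ℤ.* z ℤ.^ e)) (ℕ.+-∸-assoc 1 j<m) ⟩
  fromℤ (b ℤ.* (z ℤ.* w))                     ≡⟨ fromℤ-homo-* b (z ℤ.* w) ⟩
  fromℤ b * fromℤ (z ℤ.* w)                   ≡⟨ cong (fromℤ b *_) (fromℤ-homo-* z w) ⟩
  fromℤ b * (fromℤ z * fromℤ w)
    ≡⟨ solve 3 (λ b z w → b :* (z :* w) := z :* (b :* w)) refl (fromℤ b) (fromℤ z) (fromℤ w) ⟩
  fromℤ z * (fromℤ b * fromℤ w)               ≡⟨ cong (fromℤ z *_) (fromℤ-homo-* b w) ⟨
  fromℤ z * term m z (suc j)                  ∎
  where
  b = + (m C suc j)
  w = z ℤ.^ (m ℕ.∸ suc j)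

term-suc-suc : ∀ m z j → term (suc m) z (suc j) ≡ term m z j + fromℤ z * term m z (suc j)
term-suc-suc m z j = begin
  fromℤ (+ (suc m C suc j) ℤ.* w)
    ≡⟨ cong (λ b → fromℤ (+ b ℤ.* w)) (nCk+nC[k+1]≡[n+1]C[k+1] m j) ⟨
  fromℤ (+ (m C j ℕ.+ m C suc j) ℤ.* w)
    ≡⟨ cong (λ b → fromℤ (b ℤ.* w)) (ℤ.pos-+ (m C j) (m C suc j)) ⟩
  fromℤ ((+ (m C j) ℤ.+ + (m C suc j)) ℤ.* w)
    ≡⟨ cong fromℤ (ℤ.*-distribʳ-+ w (+ (m C j)) (+ (m C suc j))) ⟩
  fromℤ (+ (m C j) ℤ.* w ℤ.+ + (m C suc j) ℤ.* w)
    ≡⟨ fromℤ-homo-+ (+ (m C j) ℤ.* w) (+ (m C suc j) ℤ.* w) ⟩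
  term m z j + fromℤ (+ (m C suc j) ℤ.* w)
    ≡⟨ cong (λ u → term m z j + u) (term-lower m z j) ⟩
  term m z j + fromℤ z * term m z (suc j)                   ∎
  where w = z ℤ.^ (m ℕ.∸ j)

-- Makes the truncation in `N` and `D` invisible: beyond the range the binomial coefficients vanish
-- anyway, so later arguments need no range conditions.
coeff-applyUpTo : ∀ f n → (∀ k → n ℕ.≤ k → f k ≡ 0ℚ) → ∀ k → coeff (applyUpTo f n) k ≡ f k
coeff-applyUpTo f zero    f≡0 k       = sym (f≡0 k z≤n)
coeff-applyUpTo f (suc n) f≡0 zero    = refl
coeff-applyUpTo f (suc n) f≡0 (suc k) = coeff-applyUpTo (f ∘ suc) n (λ i n≤i → f≡0 (suc i) (s≤s n≤i)) k

⌊m/2⌋<k⇒m<2*k : ∀ {m k} → ⌊ m /2⌋ ℕ.< k → m ℕ.< 2 ℕ.* k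
⌊m/2⌋<k⇒m<2*k {m} {k} m/2<k = ℕ.≰⇒> λ 2k≤m → ℕ.<⇒≱ m/2<k (halve 2k≤m)
  where
  halve : 2 ℕ.* k ℕ.≤ m → k ℕ.≤ ⌊ m /2⌋
  halve 2k≤m = ℕ.≤-trans (ℕ.≤-reflexive (ℕ.n≡⌊n+n/2⌋ k))
    (ℕ.⌊n/2⌋-mono (ℕ.≤-trans (ℕ.≤-reflexive (cong (k ℕ.+_) (sym (ℕ.+-identityʳ k)))) 2k≤m))

2*[1+k]≡1+[2*k+1] : ∀ k → 2 ℕ.* suc k ≡ suc (2 ℕ.* k ℕ.+ 1)
2*[1+k]≡1+[2*k+1] k = cong suc (trans (ℕ.+-suc k (k ℕ.+ 0)) (ℕ.+-comm 1 (2 ℕ.* k)))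

coeff-N : ∀ m z k → coeff (N m z) k ≡ term m z (2 ℕ.* k)
coeff-N m z = coeff-applyUpTo _ (suc ⌊ m /2⌋) λ k m/2<k → term-beyond z (⌊m/2⌋<k⇒m<2*k m/2<k)

coeff-D : ∀ m z k → coeff (D m z) k ≡ term m z (2 ℕ.* k ℕ.+ 1)
-- `⌈ m /2⌉` is by definition `⌊ suc m /2⌋`, so the bound for floors is used at `suc m` and `suc k`
-- and then lowered by one.
coeff-D m z = coeff-applyUpTo _ ⌈ m /2⌉ λ k m/2≤k → term-beyond z
  (ℕ.≤-pred (subst (suc m ℕ.<_) (2*[1+k]≡1+[2*k+1] k) (⌊m/2⌋<k⇒m<2*k (s≤s m/2≤k))))

-- The rational part of (z + √x)(Nₘ + Dₘ√x). At index 2k Pascal's rule reaches back to 2k - 1, an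
-- index of `D`; for k = 0 there is none, which is the zero that `shift` inserts.
N-suc : ∀ m z → N (suc m) z ≈ fromℤ z · N m z ⊕ shift (D m z)
N-suc m z k = begin
  coeff (N (suc m) z) k                                 ≡⟨ coeff-N (suc m) z k ⟩
  term (suc m) z (2 ℕ.* k)                              ≡⟨ lemma k ⟩
  fromℤ z * term m z (2 ℕ.* k) + coeff (shift (D m z)) k
    ≡⟨ cong (λ u → fromℤ z * u + coeff (shift (D m z)) k) (coeff-N m z k) ⟨
  fromℤ z * coeff (N m z) k + coeff (shift (D m z)) k
    ≡⟨ cong (_+ coeff (shift (D m z)) k) (coeff-· (fromℤ z) (N m z) k) ⟨
  coeff (fromℤ z · N m z) k + coeff (shift (D m z)) k
    ≡⟨ coeff-⊕ (fromℤ z · N m z) (shift (D m z)) k ⟨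
  coeff (fromℤ z · N m z ⊕ shift (D m z)) k             ∎
  where
  lemma : ∀ k → term (suc m) z (2 ℕ.* k) ≡ fromℤ z * term m z (2 ℕ.* k) + coeff (shift (D m z)) k
  lemma zero    = trans (term-suc-zero m z) (sym (ℚ.+-identityʳ _))
  lemma (suc k) = subst (λ i → term (suc m) z i ≡ fromℤ z * term m z i + coeff (D m z) k)
    (sym (2*[1+k]≡1+[2*k+1] k)) (begin
      term (suc m) z (suc j)                           ≡⟨ term-suc-suc m z j ⟩
      term m z j + fromℤ z * term m z (suc j)
        ≡⟨ ℚ.+-comm (term m z j) (fromℤ z * term m z (suc j)) ⟩
      fromℤ z * term m z (suc j) + term m z j
        ≡⟨ cong (λ u → fromℤ z * term m z (suc j) + u) (coeff-D m z k) ⟨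
      fromℤ z * term m z (suc j) + coeff (D m z) k     ∎)
    where j = 2 ℕ.* k ℕ.+ 1

-- The coefficient of √x in the same product; index 2k + 1 reaches back to 2k, so no shift occurs.
D-suc : ∀ m z → D (suc m) z ≈ N m z ⊕ fromℤ z · D m z
D-suc m z k = begin
  coeff (D (suc m) z) k                                 ≡⟨ coeff-D (suc m) z k ⟩
  term (suc m) z (j ℕ.+ 1)                              ≡⟨ cong (term (suc m) z) (ℕ.+-comm j 1) ⟩
  term (suc m) z (suc j)                                ≡⟨ term-suc-suc m z j ⟩
  term m z j + fromℤ z * term m z (suc j)
    ≡⟨ cong (λ i → term m z j + fromℤ z * term m z i) (ℕ.+-comm 1 j) ⟩
  term m z j + fromℤ z * term m z (j ℕ.+ 1)
    ≡⟨ cong₂ (λ u v → u + fromℤ z * v) (coeff-N m z k) (coeff-D m z k) ⟨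
  coeff (N m z) k + fromℤ z * coeff (D m z) k
    ≡⟨ cong (λ u → coeff (N m z) k + u) (coeff-· (fromℤ z) (D m z) k) ⟨
  coeff (N m z) k + coeff (fromℤ z · D m z) k           ≡⟨ coeff-⊕ (N m z) (fromℤ z · D m z) k ⟨
  coeff (N m z ⊕ fromℤ z · D m z) k                     ∎
  where j = 2 ℕ.* k

eval-N-suc : ∀ m z x → eval (N (suc m) z) x ≡ fromℤ z * eval (N m z) x + x * eval (D m z) x
eval-N-suc m z x = begin
  eval (N (suc m) z) x
    ≡⟨ eval-cong (N (suc m) z) (fromℤ z · N m z ⊕ shift (D m z)) x (N-suc m z) ⟩
  eval (fromℤ z · N m z ⊕ shift (D m z)) x
    ≡⟨ eval-⊕ (fromℤ z · N m z) (shift (D m z)) x ⟩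
  eval (fromℤ z · N m z) x + eval (shift (D m z)) x
    ≡⟨ cong₂ _+_ (eval-· (fromℤ z) (N m z) x) (eval-shift (D m z) x) ⟩
  fromℤ z * eval (N m z) x + x * eval (D m z) x             ∎

eval-D-suc : ∀ m z x → eval (D (suc m) z) x ≡ eval (N m z) x + fromℤ z * eval (D m z) x
eval-D-suc m z x = begin
  eval (D (suc m) z) x
    ≡⟨ eval-cong (D (suc m) z) (N m z ⊕ fromℤ z · D m z) x (D-suc m z) ⟩
  eval (N m z ⊕ fromℤ z · D m z) x                          ≡⟨ eval-⊕ (N m z) (fromℤ z · D m z) x ⟩
  eval (N m z) x + eval (fromℤ z · D m z) x
    ≡⟨ cong (λ u → eval (N m z) x + u) (eval-· (fromℤ z) (D m z) x) ⟩
  eval (N m z) x + fromℤ z * eval (D m z) x                 ∎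

polyTaylor-N-suc : ∀ c m z k → polyTaylor c (N (suc m) z) k ≡
  fromℤ z * polyTaylor c (N m z) k + mulx c (polyTaylor c (D m z)) k
polyTaylor-N-suc c m z k = begin
  polyTaylor c (N (suc m) z) k
    ≡⟨ polyTaylor-cong c (N (suc m) z) (fromℤ z · N m z ⊕ shift (D m z)) (N-suc m z) k ⟩
  polyTaylor c (fromℤ z · N m z ⊕ shift (D m z)) k
    ≡⟨ polyTaylor-⊕ c (fromℤ z · N m z) (shift (D m z)) k ⟩
  polyTaylor c (fromℤ z · N m z) k + polyTaylor c (shift (D m z)) k
    ≡⟨ cong₂ _+_ (polyTaylor-· c (fromℤ z) (N m z) k) (polyTaylor-shift c (D m z) k) ⟩
  fromℤ z * polyTaylor c (N m z) k + mulx c (polyTaylor c (D m z)) k ∎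

polyTaylor-D-suc : ∀ c m z k → polyTaylor c (D (suc m) z) k ≡
  polyTaylor c (N m z) k + fromℤ z * polyTaylor c (D m z) k
polyTaylor-D-suc c m z k = begin
  polyTaylor c (D (suc m) z) k
    ≡⟨ polyTaylor-cong c (D (suc m) z) (N m z ⊕ fromℤ z · D m z) (D-suc m z) k ⟩
  polyTaylor c (N m z ⊕ fromℤ z · D m z) k
    ≡⟨ polyTaylor-⊕ c (N m z) (fromℤ z · D m z) k ⟩
  polyTaylor c (N m z) k + polyTaylor c (fromℤ z · D m z) k
    ≡⟨ cong (λ u → polyTaylor c (N m z) k + u) (polyTaylor-· c (fromℤ z) (D m z) k) ⟩
  polyTaylor c (N m z) k + fromℤ z * polyTaylor c (D m z) k ∎

-- Addition and doubling formulas

eval-N-0 : ∀ z x → eval (N 0 z) x ≡ 1ℚ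
eval-N-0 z x = trans (cong (λ u → 1ℚ + u) (ℚ.*-zeroʳ x)) (ℚ.+-identityʳ 1ℚ)

-- The two components of (z + √x)ᵃ(z + √x)ᵇ. They are proved together because each recurrence
-- involves both `N` and `D`.
eval-N-D-+ : ∀ a b z x →
  (eval (N (a ℕ.+ b) z) x ≡ eval (N a z) x * eval (N b z) x + x * (eval (D a z) x * eval (D b z) x)) ×
  (eval (D (a ℕ.+ b) z) x ≡ eval (N a z) x * eval (D b z) x + eval (D a z) x * eval (N b z) x)
eval-N-D-+ zero b z x =
    trans (base₁ (eval (N b z) x) (eval (D b z) x))
      (cong (λ u → u * eval (N b z) x + x * (0ℚ * eval (D b z) x)) (sym (eval-N-0 z x)))
  , trans (base₂ (eval (N b z) x) (eval (D b z) x))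
      (cong (λ u → u * eval (D b z) x + 0ℚ * eval (N b z) x) (sym (eval-N-0 z x)))
  where
  base₁ : ∀ n d → n ≡ 1ℚ * n + x * (0ℚ * d)
  base₁ = solve 3 (λ x n d → n := con 1ℚ :* n :+ x :* (con 0ℚ :* d)) refl x
  base₂ : ∀ n d → d ≡ 1ℚ * d + 0ℚ * n
  base₂ = solve 2 (λ n d → d := con 1ℚ :* d :+ con 0ℚ :* n) refl
eval-N-D-+ (suc a) b z x =
    trans (eval-N-suc (a ℕ.+ b) z x) (step₁ (fromℤ z) {m} {e} {n = n} {d} (eval-N-suc a z x) (eval-D-suc a z x) ih)
  , trans (eval-D-suc (a ℕ.+ b) z x) (step₂ (fromℤ z) {m} {e} {n = n} {d} (eval-N-suc a z x) (eval-D-suc a z x) ih)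
  where
  ih = eval-N-D-+ a b z x
  m = eval (N a z) x
  e = eval (D a z) x
  n = eval (N b z) x
  d = eval (D b z) x
  -- Abstracting the evaluations to variables lets the hypotheses be matched with `refl`, leaving a
  -- pure ring identity.
  step₁ : ∀ z {m e m′ e′ n d u v} → m′ ≡ z * m + x * e → e′ ≡ m + z * e →
    (u ≡ m * n + x * (e * d)) × (v ≡ m * d + e * n) → z * u + x * v ≡ m′ * n + x * (e′ * d)
  step₁ z {m} {e} {_} {_} {n} {d} refl refl (refl , refl) =
    solve 6 (λ z x m e n d → z :* (m :* n :+ x :* (e :* d)) :+ x :* (m :* d :+ e :* n)
                := (z :* m :+ x :* e) :* n :+ x :* ((m :+ z :* e) :* d)) refl z x m e n d
  step₂ : ∀ z {m e m′ e′ n d u v} → m′ ≡ z * m + x * e → e′ ≡ m + z * e →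
    (u ≡ m * n + x * (e * d)) × (v ≡ m * d + e * n) → u + z * v ≡ m′ * d + e′ * n
  step₂ z {m} {e} {_} {_} {n} {d} refl refl (refl , refl) =
    solve 6 (λ z x m e n d → (m :* n :+ x :* (e :* d)) :+ z :* (m :* d :+ e :* n)
                := (z :* m :+ x :* e) :* d :+ (m :+ z :* e) :* n) refl z x m e n d

eval-N-double : ∀ m z x → eval (N (2 ℕ.* m) z) x ≡
  eval (N m z) x * eval (N m z) x + x * (eval (D m z) x * eval (D m z) x)
eval-N-double m z x = trans (cong (λ k → eval (N (m ℕ.+ k) z) x) (ℕ.+-identityʳ m))
  (proj₁ (eval-N-D-+ m m z x))

eval-D-double : ∀ m z x → eval (D (2 ℕ.* m) z) x ≡ two * (eval (N m z) x * eval (D m z) x)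
eval-D-double m z x = trans (cong (λ k → eval (D (m ℕ.+ k) z) x) (ℕ.+-identityʳ m))
  (trans (proj₂ (eval-N-D-+ m m z x))
    (solve 2 (λ n d → n :* d :+ d :* n := con two :* (n :* d)) refl (eval (N m z) x) (eval (D m z) x)))

eval-D-1 : ∀ z x → eval (D 1 z) x ≡ 1ℚ
eval-D-1 z x = trans (cong (λ u → 1ℚ + u) (ℚ.*-zeroʳ x)) (ℚ.+-identityʳ 1ℚ)

eval-N-1 : ∀ z x → eval (N 1 z) x ≡ fromℤ z
eval-N-1 z x = begin
  eval (N 1 z) x                   ≡⟨ eval-N-suc 0 z x ⟩
  fromℤ z * eval (N 0 z) x + x * 0ℚ ≡⟨ cong (λ u → fromℤ z * u + x * 0ℚ) (eval-N-0 z x) ⟩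
  fromℤ z * 1ℚ + x * 0ℚ
    ≡⟨ solve 2 (λ z x → z :* con 1ℚ :+ x :* con 0ℚ := z) refl (fromℤ z) x ⟩
  fromℤ z                          ∎

-- Formal power series

infixl 7 _⊛_
-- Cauchy product by splitting f as f(0) + t f⁺. The recursion runs in step with the long division
-- `quot`.
_⊛_ : Series → Series → Series
(f ⊛ g) zero    = f 0 * g 0
(f ⊛ g) (suc k) = f 0 * g (suc k) + (f ∘ suc ⊛ g) k

⊛-cong : ∀ {f f′ g g′} → (∀ k → f k ≡ f′ k) → (∀ k → g k ≡ g′ k) → ∀ k → (f ⊛ g) k ≡ (f′ ⊛ g′) k
⊛-cong f≡f′ g≡g′ zero    = cong₂ _*_ (f≡f′ 0) (g≡g′ 0)
⊛-cong f≡f′ g≡g′ (suc k) = cong₂ _+_ (cong₂ _*_ (f≡f′ 0) (g≡g′ (suc k))) (⊛-cong (f≡f′ ∘ suc) g≡g′ k)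

⊛-linearˡ : ∀ a b f g h k → ((λ i → a * f i + b * g i) ⊛ h) k ≡ a * (f ⊛ h) k + b * (g ⊛ h) k
⊛-linearˡ a b f g h zero    =
  solve 5 (λ a b f g h → (a :* f :+ b :* g) :* h := a :* (f :* h) :+ b :* (g :* h)) refl a b (f 0) (g 0) (h 0)
⊛-linearˡ a b f g h (suc k) = trans
  (cong (λ u → (a * f 0 + b * g 0) * h (suc k) + u) (⊛-linearˡ a b (f ∘ suc) (g ∘ suc) h k))
  (solve 7 (λ a b f g h u v → (a :* f :+ b :* g) :* h :+ (a :* u :+ b :* v)
              := a :* (f :* h :+ u) :+ b :* (g :* h :+ v))
    refl a b (f 0) (g 0) (h (suc k)) ((f ∘ suc ⊛ h) k) ((g ∘ suc ⊛ h) k))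

⊛-linearʳ : ∀ a b f g h k → (f ⊛ (λ i → a * g i + b * h i)) k ≡ a * (f ⊛ g) k + b * (f ⊛ h) k
⊛-linearʳ a b f g h zero    =
  solve 5 (λ a b f g h → f :* (a :* g :+ b :* h) := a :* (f :* g) :+ b :* (f :* h)) refl a b (f 0) (g 0) (h 0)
⊛-linearʳ a b f g h (suc k) = trans
  (cong (λ u → f 0 * (a * g (suc k) + b * h (suc k)) + u) (⊛-linearʳ a b (f ∘ suc) g h k))
  (solve 7 (λ a b f g h u v → f :* (a :* g :+ b :* h) :+ (a :* u :+ b :* v)
              := a :* (f :* g :+ u) :+ b :* (f :* h :+ v))
    refl a b (f 0) (g (suc k)) (h (suc k)) ((f ∘ suc ⊛ g) k) ((f ∘ suc ⊛ h) k))

⊛-assoc : ∀ f g h k → ((f ⊛ g) ⊛ h) k ≡ (f ⊛ (g ⊛ h)) k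
⊛-assoc f g h zero    = ℚ.*-assoc (f 0) (g 0) (h 0)
⊛-assoc f g h (suc k) = begin
  f 0 * g 0 * h (suc k) + ((λ i → f 0 * g (suc i) + (f ∘ suc ⊛ g) i) ⊛ h) k
    -- The factor `1ℚ` gives the tail of `f ⊛ g` the form of a linear combination, as `⊛-linearˡ`
    -- requires.
    ≡⟨ cong (λ u → f 0 * g 0 * h (suc k) + u) (⊛-cong {g = h}
         (λ i → cong (λ u → f 0 * g (suc i) + u) (sym (ℚ.*-identityˡ ((f ∘ suc ⊛ g) i)))) (λ _ → refl) k) ⟩
  f 0 * g 0 * h (suc k) + ((λ i → f 0 * g (suc i) + 1ℚ * (f ∘ suc ⊛ g) i) ⊛ h) k
    ≡⟨ cong (λ u → f 0 * g 0 * h (suc k) + u) (⊛-linearˡ (f 0) 1ℚ (g ∘ suc) (f ∘ suc ⊛ g) h k) ⟩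
  f 0 * g 0 * h (suc k) + (f 0 * (g ∘ suc ⊛ h) k + 1ℚ * ((f ∘ suc ⊛ g) ⊛ h) k)
    ≡⟨ cong (λ u → f 0 * g 0 * h (suc k) + (f 0 * (g ∘ suc ⊛ h) k + 1ℚ * u)) (⊛-assoc (f ∘ suc) g h k) ⟩
  f 0 * g 0 * h (suc k) + (f 0 * (g ∘ suc ⊛ h) k + 1ℚ * (f ∘ suc ⊛ (g ⊛ h)) k)
    ≡⟨ solve 5 (λ f g h u v → f :* g :* h :+ (f :* u :+ con 1ℚ :* v) := f :* (g :* h :+ u) :+ v)
         refl (f 0) (g 0) (h (suc k)) ((g ∘ suc ⊛ h) k) ((f ∘ suc ⊛ (g ⊛ h)) k) ⟩
  f 0 * (g 0 * h (suc k) + (g ∘ suc ⊛ h) k) + (f ∘ suc ⊛ (g ⊛ h)) k ∎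

-- Every other summand of the convolution contains a coefficient of `g` below `k`.
⊛-order : ∀ f g k → (∀ i → i ℕ.< k → g i ≡ 0ℚ) → (f ⊛ g) k ≡ f 0 * g k
⊛-order f g zero    g≡0 = refl
⊛-order f g (suc k) g≡0 = begin
  f 0 * g (suc k) + (f ∘ suc ⊛ g) k
    ≡⟨ cong (λ u → f 0 * g (suc k) + u) (⊛-order (f ∘ suc) g k (λ i i<k → g≡0 i (ℕ.m<n⇒m<1+n i<k))) ⟩
  f 0 * g (suc k) + f 1 * g k        ≡⟨ cong (λ u → f 0 * g (suc k) + f 1 * u) (g≡0 k (ℕ.n<1+n k)) ⟩
  f 0 * g (suc k) + f 1 * 0ℚ
    ≡⟨ solve 2 (λ u v → u :+ v :* con 0ℚ := u) refl (f 0 * g (suc k)) (f 1) ⟩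
  f 0 * g (suc k)                    ∎

-- The mirror image of the defining recursion, splitting off the constant term of the right factor.
⊛-sucʳ : ∀ f g k → (f ⊛ g) (suc k) ≡ (f ⊛ g ∘ suc) k + f (suc k) * g 0
⊛-sucʳ f g zero    = refl
⊛-sucʳ f g (suc k) = trans (cong (λ u → f 0 * g (suc (suc k)) + u) (⊛-sucʳ (f ∘ suc) g k))
  (sym (ℚ.+-assoc (f 0 * g (suc (suc k))) ((f ∘ suc ⊛ g ∘ suc) k) (f (suc (suc k)) * g 0)))

-- The derivations d/dt and t d/dt.
∂ θ : Series → Series
∂ f k = fromℤ (+ suc k) * f (suc k)
θ f k = fromℤ (+ k) * f k

fromℤ-suc : ∀ k → fromℤ (+ suc k) ≡ 1ℚ + fromℤ (+ k)
fromℤ-suc k = fromℤ-homo-+ (+ 1) (+ k)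

-- `θ g` is t times `∂ g`; its zero constant term removes the extra summand.
⊛-∂ : ∀ f g k → (f ⊛ ∂ g) k ≡ (f ⊛ θ g) (suc k)
⊛-∂ f g k = sym (trans (⊛-sucʳ f (θ g) k)
  (solve 3 (λ u a b → u :+ a :* (con 0ℚ :* b) := u) refl ((f ⊛ ∂ g) k) (f (suc k)) (g 0)))

-- The two Leibniz rules are mutually recursive: `θ` at `suc k` is `∂` at `k`, and for f = f(0) + t
-- f⁺ one has `∂ f` = f⁺ + `θ` f⁺, so `∂` at `k` needs `θ` at `k` for the tail f⁺.
θ-⊛ : ∀ f g k → θ (f ⊛ g) k ≡ (θ f ⊛ g) k + (f ⊛ θ g) k
∂-⊛ : ∀ f g k → ∂ (f ⊛ g) k ≡ (∂ f ⊛ g) k + (f ⊛ ∂ g) k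

θ-⊛ f g zero    = solve 2 (λ a b → con 0ℚ :* (a :* b) := con 0ℚ :* a :* b :+ a :* (con 0ℚ :* b)) refl (f 0) (g 0)
θ-⊛ f g (suc k) = begin
  ∂ (f ⊛ g) k                               ≡⟨ ∂-⊛ f g k ⟩
  (∂ f ⊛ g) k + (f ⊛ ∂ g) k                 ≡⟨ cong (λ u → (∂ f ⊛ g) k + u) (⊛-∂ f g k) ⟩
  (∂ f ⊛ g) k + (f ⊛ θ g) (suc k)
    ≡⟨ solve 4 (λ a b u v → u :+ v := con 0ℚ :* a :* b :+ u :+ v) refl (f 0) (g (suc k)) ((∂ f ⊛ g) k) ((f ⊛ θ g) (suc k)) ⟩
  (θ f ⊛ g) (suc k) + (f ⊛ θ g) (suc k)     ∎

∂-⊛ f g k = begin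
  fromℤ (+ suc k) * (f 0 * g (suc k) + (f ∘ suc ⊛ g) k)
    ≡⟨ expand ⟩
  1ℚ * (f ∘ suc ⊛ g) k + fromℤ (+ k) * (f ∘ suc ⊛ g) k + f 0 * ∂ g k
    ≡⟨ cong (λ u → 1ℚ * (f ∘ suc ⊛ g) k + u + f 0 * ∂ g k) (θ-⊛ (f ∘ suc) g k) ⟩
  1ℚ * (f ∘ suc ⊛ g) k + ((θ (f ∘ suc) ⊛ g) k + (f ∘ suc ⊛ θ g) k) + f 0 * ∂ g k
    ≡⟨ solve 4 (λ u v w a → con 1ℚ :* u :+ (v :+ w) :+ a := (con 1ℚ :* u :+ con 1ℚ :* v) :+ (a :+ w))
         refl ((f ∘ suc ⊛ g) k) ((θ (f ∘ suc) ⊛ g) k) ((f ∘ suc ⊛ θ g) k) (f 0 * ∂ g k) ⟩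
  (1ℚ * (f ∘ suc ⊛ g) k + 1ℚ * (θ (f ∘ suc) ⊛ g) k) + (f ⊛ θ g) (suc k)
    ≡⟨ cong₂ _+_ (⊛-linearˡ 1ℚ 1ℚ (f ∘ suc) (θ (f ∘ suc)) g k) (⊛-∂ f g k) ⟨
  ((λ i → 1ℚ * f (suc i) + 1ℚ * θ (f ∘ suc) i) ⊛ g) k + (f ⊛ ∂ g) k
    ≡⟨ cong (_+ (f ⊛ ∂ g) k) (⊛-cong {g = g} ∂≡ (λ _ → refl) k) ⟨
  (∂ f ⊛ g) k + (f ⊛ ∂ g) k ∎
  where
  ∂≡ : ∀ i → ∂ f i ≡ 1ℚ * f (suc i) + 1ℚ * θ (f ∘ suc) i
  ∂≡ i = trans (cong (_* f (suc i)) (fromℤ-suc i))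
    (solve 2 (λ n a → (con 1ℚ :+ n) :* a := con 1ℚ :* a :+ con 1ℚ :* (n :* a)) refl (fromℤ (+ i)) (f (suc i)))
  expand : fromℤ (+ suc k) * (f 0 * g (suc k) + (f ∘ suc ⊛ g) k) ≡
    1ℚ * (f ∘ suc ⊛ g) k + fromℤ (+ k) * (f ∘ suc ⊛ g) k + f 0 * ∂ g k
  expand rewrite fromℤ-suc k =
    solve 4 (λ n a b u → (con 1ℚ :+ n) :* (a :* b :+ u) := con 1ℚ :* u :+ n :* u :+ a :* ((con 1ℚ :+ n) :* b))
      refl (fromℤ (+ k)) (f 0) (g (suc k)) ((f ∘ suc ⊛ g) k)

mulx-⊛ : ∀ c f g → g 0 ≡ c → g 1 ≡ 1ℚ → (∀ k → g (suc (suc k)) ≡ 0ℚ) → ∀ k → (g ⊛ f) k ≡ mulx c f k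
mulx-⊛ c f g g0 g1 g2+ zero    = cong (_* f 0) g0
mulx-⊛ c f g g0 g1 g2+ (suc k) = cong₂ _+_ (cong (_* f (suc k)) g0) (unit k)
  where
  null : ∀ h k → (∀ k → h k ≡ 0ℚ) → (h ⊛ f) k ≡ 0ℚ
  null h zero    h≡0 = trans (cong (_* f 0) (h≡0 0)) (ℚ.*-zeroˡ (f 0))
  null h (suc k) h≡0 = trans (cong₂ (λ u v → u * f (suc k) + v) (h≡0 0) (null (h ∘ suc) k (h≡0 ∘ suc)))
    (solve 1 (λ a → con 0ℚ :* a :+ con 0ℚ := con 0ℚ) refl (f (suc k)))
  unit : ∀ k → (g ∘ suc ⊛ f) k ≡ f k
  unit zero    = trans (cong (_* f 0) g1) (ℚ.*-identityˡ (f 0))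
  unit (suc k) = trans (cong₂ (λ u v → u * f (suc k) + v) g1 (null (g ∘ suc ∘ suc) k g2+))
    (solve 1 (λ a → con 1ℚ :* a :+ con 0ℚ := a) refl (f (suc k)))

-- Coefficient `k` of a quotient depends only on coefficients up to `k`, so agreement below `M`
-- suffices. Removing s(0) r and dividing by t is one step of long division and lowers `M` by one.
quot-unique : ∀ M p r s .{{_ : ℚ.NonZero (r 0)}} → (∀ i → i ℕ.< M → (s ⊛ r) i ≡ p i) →
  ∀ k → k ℕ.< M → quot p r k ≡ s k
quot-unique (suc M) p r s s⊛r≡p zero    _         = ÷-unique (r 0) (s⊛r≡p 0 (s≤s z≤n))
quot-unique (suc M) p r s s⊛r≡p (suc k) (s≤s k<M) = quot-unique M _ r (s ∘ suc) tail k k<M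
  where
  tail : ∀ i → i ℕ.< M → (s ∘ suc ⊛ r) i ≡ p (suc i) - (p 0 ÷ r 0) * r (suc i)
  tail i i<M = begin
    (s ∘ suc ⊛ r) i
      ≡⟨ solve 2 (λ u v → u := v :+ u :- v) refl ((s ∘ suc ⊛ r) i) (s 0 * r (suc i)) ⟩
    (s ⊛ r) (suc i) - s 0 * r (suc i)
      ≡⟨ cong₂ (λ u v → u - v * r (suc i)) (s⊛r≡p (suc i) (s≤s i<M)) (sym (÷-unique {w = s 0} (r 0) (s⊛r≡p 0 (s≤s z≤n)))) ⟩
    p (suc i) - (p 0 ÷ r 0) * r (suc i) ∎

-- The Taylor series of √x

-- The cases follow the change of base in `_^ᶻ_` from `r` to its inverse below exponent 0.
^ᶻ-pred : ∀ r .{{_ : ℚ.NonZero r}} i → r ^ᶻ i ≡ r * r ^ᶻ ℤ.pred i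
^ᶻ-pred r (+ zero)      = sym (trans (cong (r *_) (ℚ.*-identityʳ (1/ r))) (ℚ.*-inverseʳ r))
^ᶻ-pred r (ℤ.+[1+ n ])  = refl
^ᶻ-pred r (ℤ.-[1+ n ])  = begin
  w                     ≡⟨ ℚ.*-identityˡ w ⟨
  1ℚ * w                ≡⟨ cong (_* w) (ℚ.*-inverseʳ r) ⟨
  r * (1/ r) * w        ≡⟨ ℚ.*-assoc r (1/ r) w ⟩
  r * ((1/ r) * w)      ∎
  where w = r ^ᶻ ℤ.-[1+ n ]

^ᶻ-minus-2 : ∀ r .{{_ : ℚ.NonZero r}} i → r ^ᶻ i ≡ r * (r * r ^ᶻ (i ℤ.- + 2))
^ᶻ-minus-2 r i = trans (^ᶻ-pred r i) (cong (r *_) (trans (^ᶻ-pred r (ℤ.pred i))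
  (cong (λ j → r * r ^ᶻ j) (trans (sym (ℤ.+-assoc ℤ.-1ℤ ℤ.-1ℤ i)) (ℤ.+-comm (ℤ.- + 2) i)))))

√-derivs : ℕ → HalfPower
√-derivs = fold (fromℤ (+ 1) ·x^ + 1 /2) derivHalf

twice-√-derivs : ∀ k → fromℤ (HalfPower.twice (√-derivs k)) ≡ 1ℚ - two * fromℤ (+ k)
twice-√-derivs zero    = refl
twice-√-derivs (suc k) = begin
  fromℤ (m ℤ.- + 2)                         ≡⟨ fromℤ-homo-+ m (ℤ.- + 2) ⟩
  fromℤ m + fromℤ (ℤ.- + 2)                 ≡⟨ cong (_+ fromℤ (ℤ.- + 2)) (twice-√-derivs k) ⟩
  1ℚ - two * fromℤ (+ k) + fromℤ (ℤ.- + 2)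
    ≡⟨ solve 1 (λ n → con 1ℚ :- con two :* n :+ con (fromℤ (ℤ.- + 2)) := con 1ℚ :- con two :* (con 1ℚ :+ n))
         refl (fromℤ (+ k)) ⟩
  1ℚ - two * (1ℚ + fromℤ (+ k))             ≡⟨ cong (λ n → 1ℚ - two * n) (fromℤ-suc k) ⟨
  1ℚ - two * fromℤ (+ suc k)                ∎
  where m = HalfPower.twice (√-derivs k)

module _ (r : ℚ) .{{r≢0 : ℚ.NonZero r}} where

  private s = √-taylor r

  √-taylor-0 : s 0 ≡ r
  √-taylor-0 = solve 1 (λ r → con 1ℚ :* (r :* con 1ℚ) :* con 1ℚ := r) refl r

  -- 2 x s′ = s for s = √x, where x s′ = c s′ + t s′.  The factor 1ℚ makes the right-hand
  -- side a linear combination to which ⊛-linearˡ and ⊛-linearʳ apply.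
  √-taylor-ode : ∀ k → two * (r * r) * ∂ s k ≡ 1ℚ * s k + (- two) * θ s k
  √-taylor-ode k = begin
    two * (r * r) * (n * (a * (m / 2) * p′ * i′))
      ≡⟨ solve 7 (λ t r n a h p i → t :* (r :* r) :* (n :* (a :* h :* p :* i)) := a :* (h :* t) :* (r :* (r :* p)) :* (i :* n))
           refl two r n a (m / 2) p′ i′ ⟩
    a * ((m / 2) * two) * (r * (r * p′)) * (i′ * n)
      ≡⟨ cong₂ _*_ (cong₂ (λ u v → a * u * v) (trans (/-*-cancel m 2) (twice-√-derivs k)) (sym (^ᶻ-minus-2 r m))) (invFact-suc k) ⟩
    a * (1ℚ - two * fromℤ (+ k)) * p * invFact k
      ≡⟨ solve 5 (λ a t n p i → a :* (con 1ℚ :- t :* n) :* p :* i := con 1ℚ :* (a :* p :* i) :+ (:- t) :* (n :* (a :* p :* i)))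
           refl a two (fromℤ (+ k)) p (invFact k) ⟩
    1ℚ * s k + (- two) * θ s k ∎
    where
    a = HalfPower.factor (√-derivs k)
    m = HalfPower.twice (√-derivs k)
    p = r ^ᶻ m
    p′ = r ^ᶻ (m ℤ.- + 2)
    n = fromℤ (+ suc k)
    i′ = invFact (suc k)

  -- For y = s², 2 x s′ = s gives x y′ = 2 x s s′ = y. With x = c + t, the part t y′ = `θ y` moves
  -- to the right and produces the factor 1 - k.
  √-taylor-square-ode : ∀ k → r * r * ∂ (s ⊛ s) k ≡ (1ℚ - fromℤ (+ k)) * (s ⊛ s) k
  √-taylor-square-ode k = *-cancelʳ two (fromℤ≢0 λ ()) (begin
    c * ∂ (s ⊛ s) k * two
      ≡⟨ cong (λ u → c * u * two) (∂-⊛ s s k) ⟩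
    c * ((∂ s ⊛ s) k + (s ⊛ ∂ s) k) * two
      -- The zero summands bring a plain multiple into the two-term form of `⊛-linearˡ` and
      -- `⊛-linearʳ`.
      ≡⟨ solve 4 (λ c t u v → c :* (u :+ v) :* t := (t :* c :* u :+ con 0ℚ :* u) :+ (t :* c :* v :+ con 0ℚ :* v))
           refl c two ((∂ s ⊛ s) k) ((s ⊛ ∂ s) k) ⟩
    (two * c * (∂ s ⊛ s) k + 0ℚ * (∂ s ⊛ s) k) + (two * c * (s ⊛ ∂ s) k + 0ℚ * (s ⊛ ∂ s) k)
      ≡⟨ cong₂ _+_ (⊛-linearˡ (two * c) 0ℚ (∂ s) (∂ s) s k) (⊛-linearʳ (two * c) 0ℚ s (∂ s) (∂ s) k) ⟨
    ((λ i → two * c * ∂ s i + 0ℚ * ∂ s i) ⊛ s) k + (s ⊛ (λ i → two * c * ∂ s i + 0ℚ * ∂ s i)) k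
      ≡⟨ cong₂ _+_ (⊛-cong {g = s} ode (λ _ → refl) k) (⊛-cong {f = s} (λ _ → refl) ode k) ⟩
    ((λ i → 1ℚ * s i + (- two) * θ s i) ⊛ s) k + (s ⊛ (λ i → 1ℚ * s i + (- two) * θ s i)) k
      ≡⟨ cong₂ _+_ (⊛-linearˡ 1ℚ (- two) s (θ s) s k) (⊛-linearʳ 1ℚ (- two) s s (θ s) k) ⟩
    (1ℚ * (s ⊛ s) k + (- two) * (θ s ⊛ s) k) + (1ℚ * (s ⊛ s) k + (- two) * (s ⊛ θ s) k)
      ≡⟨ solve 3 (λ u v w → (con 1ℚ :* u :+ (:- con two) :* v) :+ (con 1ℚ :* u :+ (:- con two) :* w)
                   := con two :* u :- con two :* (v :+ w)) refl ((s ⊛ s) k) ((θ s ⊛ s) k) ((s ⊛ θ s) k) ⟩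
    two * (s ⊛ s) k - two * ((θ s ⊛ s) k + (s ⊛ θ s) k)
      ≡⟨ cong (λ u → two * (s ⊛ s) k - two * u) (θ-⊛ s s k) ⟨
    two * (s ⊛ s) k - two * (fromℤ (+ k) * (s ⊛ s) k)
      ≡⟨ solve 3 (λ t n u → t :* u :- t :* (n :* u) := (con 1ℚ :- n) :* u :* t) refl two (fromℤ (+ k)) ((s ⊛ s) k) ⟩
    (1ℚ - fromℤ (+ k)) * (s ⊛ s) k * two                    ∎)
    where
    c = r * r
    ode : ∀ i → two * c * ∂ s i + 0ℚ * ∂ s i ≡ 1ℚ * s i + (- two) * θ s i
    ode i = trans (solve 2 (λ t u → t :* u :+ con 0ℚ :* u := t :* u) refl (two * c) (∂ s i)) (√-taylor-ode i)

  private
    c = r * r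
    y = s ⊛ s

  √-taylor-square-0 : y 0 ≡ c
  √-taylor-square-0 = cong₂ _*_ √-taylor-0 √-taylor-0

  private
    c≢0 : c ≢ 0ℚ
    c≢0 = *≢0 (nonZero⇒≢0 r) (nonZero⇒≢0 r)

  √-taylor-square-1 : y 1 ≡ 1ℚ
  √-taylor-square-1 = *-cancelʳ c c≢0 (begin
    y 1 * c             ≡⟨ solve 2 (λ u c → u :* c := c :* (con 1ℚ :* u)) refl (y 1) c ⟩
    c * ∂ y 0           ≡⟨ √-taylor-square-ode 0 ⟩
    (1ℚ - 0ℚ) * y 0     ≡⟨ cong ((1ℚ - 0ℚ) *_) √-taylor-square-0 ⟩
    1ℚ * c              ∎)

  -- The factor 1 - k vanishes at k = 1, which kills coefficient 2; from there the recurrence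
  -- propagates zero, as c and the index are invertible.
  √-taylor-square-2+ : ∀ k → y (suc (suc k)) ≡ 0ℚ
  √-taylor-square-2+ k = *-cancelʳ (c * n) (*≢0 c≢0 (fromℤ≢0 λ ())) (begin
    y (suc (suc k)) * (c * n)
      ≡⟨ solve 3 (λ u c n → u :* (c :* n) := c :* (n :* u)) refl (y (suc (suc k))) c n ⟩
    c * ∂ y (suc k)                    ≡⟨ √-taylor-square-ode (suc k) ⟩
    (1ℚ - fromℤ (+ suc k)) * y (suc k) ≡⟨ vanish k ⟩
    0ℚ                                 ≡⟨ ℚ.*-zeroˡ (c * n) ⟨
    0ℚ * (c * n)                       ∎)
    where
    n = fromℤ (+ suc (suc k))
    vanish : ∀ k → (1ℚ - fromℤ (+ suc k)) * y (suc k) ≡ 0ℚ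
    vanish zero    = ℚ.*-zeroˡ (y 1)
    vanish (suc k) = trans (cong ((1ℚ - fromℤ (+ suc (suc k))) *_) (√-taylor-square-2+ k)) (ℚ.*-zeroʳ (1ℚ - fromℤ (+ suc (suc k))))

  √-taylor-square : ∀ f k → (s ⊛ (s ⊛ f)) k ≡ mulx c f k
  √-taylor-square f k = trans (sym (⊛-assoc s s f k))
    (mulx-⊛ c f y √-taylor-square-0 √-taylor-square-1 √-taylor-square-2+ k)

-- Padé approximation

module _ (z : ℤ) .{{z≢0 : ℚ.NonZero (fromℤ z)}} where

  private
    s = √-taylor (fromℤ z)
    c = fromℤ z * fromℤ z

    P R : ℕ → Series
    P m = polyTaylor c (N m z)
    R m = polyTaylor c (D m z)

    -- (z − s)ᵐ
    E : ℕ → Series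
    E m k = 1ℚ * P m k + (- 1ℚ) * (s ⊛ R m) k

    -- Multiplication by z - s. Replacing x Dₘ by s(s Dₘ), which is s² = x, lets the new terms
    -- regroup into -s(Nₘ - s Dₘ).
    E-suc : ∀ m k → E (suc m) k ≡ fromℤ z * E m k - (s ⊛ E m) k
    E-suc m k = begin
      1ℚ * P (suc m) k + (- 1ℚ) * (s ⊛ R (suc m)) k
        ≡⟨ cong₂ (λ u v → 1ℚ * u + (- 1ℚ) * v) (polyTaylor-N-suc c m z k) sR-suc ⟩
      1ℚ * (fromℤ z * P m k + mulx c (R m) k) + (- 1ℚ) * (1ℚ * (s ⊛ P m) k + fromℤ z * (s ⊛ R m) k)
        ≡⟨ solve 5 (λ z p m t q → con 1ℚ :* (z :* p :+ m) :+ con (- 1ℚ) :* (con 1ℚ :* t :+ z :* q)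
                      := z :* (con 1ℚ :* p :+ con (- 1ℚ) :* q) :- (con 1ℚ :* t :+ con (- 1ℚ) :* m))
             refl (fromℤ z) (P m k) (mulx c (R m) k) ((s ⊛ P m) k) ((s ⊛ R m) k) ⟩
      fromℤ z * E m k - (1ℚ * (s ⊛ P m) k + (- 1ℚ) * mulx c (R m) k)
        ≡⟨ cong (λ u → fromℤ z * E m k - u) sE ⟨
      fromℤ z * E m k - (s ⊛ E m) k ∎
      where
      sR-suc : (s ⊛ R (suc m)) k ≡ 1ℚ * (s ⊛ P m) k + fromℤ z * (s ⊛ R m) k
      sR-suc = trans
        (⊛-cong {f = s} (λ _ → refl) (λ i → trans (polyTaylor-D-suc c m z i)
          (cong (_+ fromℤ z * R m i) (sym (ℚ.*-identityˡ (P m i))))) k)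
        (⊛-linearʳ 1ℚ (fromℤ z) s (P m) (R m) k)
      sE : (s ⊛ E m) k ≡ 1ℚ * (s ⊛ P m) k + (- 1ℚ) * mulx c (R m) k
      sE = trans (⊛-linearʳ 1ℚ (- 1ℚ) s (P m) (s ⊛ R m) k)
        (cong (λ u → 1ℚ * (s ⊛ P m) k + (- 1ℚ) * u) (√-taylor-square (fromℤ z) (R m) k))

    -- Only the constant term of s contributes at index `k`. At k = m the coefficient `E m k` is not
    -- known to vanish, but its two occurrences cancel because s(0) = z.
    E-order : ∀ m k → k ℕ.< m → E m k ≡ 0ℚ
    E-order (suc m) k (s≤s k≤m) = begin
      E (suc m) k                          ≡⟨ E-suc m k ⟩
      fromℤ z * E m k - (s ⊛ E m) k
        ≡⟨ cong (λ u → fromℤ z * E m k - u) (⊛-order s (E m) k λ i i<k → E-order m i (ℕ.<-≤-trans i<k k≤m)) ⟩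
      fromℤ z * E m k - s 0 * E m k
        ≡⟨ cong (λ u → fromℤ z * E m k - u * E m k) (√-taylor-0 (fromℤ z)) ⟩
      fromℤ z * E m k - fromℤ z * E m k    ≡⟨ ℚ.+-inverseʳ (fromℤ z * E m k) ⟩
      0ℚ                                   ∎

  √-taylor-⊛-D : ∀ m k → k ℕ.< m → (s ⊛ R m) k ≡ P m k
  √-taylor-⊛-D m k k<m = begin
    (s ⊛ R m) k
      ≡⟨ solve 2 (λ p q → q := p :- (con 1ℚ :* p :+ con (- 1ℚ) :* q)) refl (P m k) ((s ⊛ R m) k) ⟩
    P m k - E m k   ≡⟨ cong (λ u → P m k - u) (E-order m k k<m) ⟩
    P m k - 0ℚ      ≡⟨ ℚ.+-identityʳ (P m k) ⟩
    P m k           ∎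

  -- At x = z² the root √x may be taken to be z, and then (z - √x)ᵐ⁺¹ = 0.
  eval-N≡z*D : ∀ m → eval (N (suc m) z) c ≡ fromℤ z * eval (D (suc m) z) c
  eval-N≡z*D m = begin
    eval (N (suc m) z) c                     ≡⟨ eval-N-suc m z c ⟩
    fromℤ z * eval (N m z) c + c * eval (D m z) c
      ≡⟨ solve 3 (λ z n d → z :* n :+ z :* z :* d := z :* (n :+ z :* d)) refl (fromℤ z) (eval (N m z) c) (eval (D m z) c) ⟩
    fromℤ z * (eval (N m z) c + fromℤ z * eval (D m z) c) ≡⟨ cong (fromℤ z *_) (eval-D-suc m z c) ⟨
    fromℤ z * eval (D (suc m) z) c           ∎

  -- With Nₘ = z Dₘ at c, the recurrence becomes Dₘ₊₁ = 2 z Dₘ, so the values are the powers of 2z.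
  eval-D≢0 : ∀ m → eval (D (suc m) z) c ≢ 0ℚ
  eval-D≢0 zero    e = fromℤ≢0 {+ 1} (λ ()) (trans (sym (eval-D-1 z c)) e)
  eval-D≢0 (suc m) e = *≢0 (*≢0 (fromℤ≢0 {+ 2} λ ()) (nonZero⇒≢0 (fromℤ z))) (eval-D≢0 m) (begin
    two * fromℤ z * d
      ≡⟨ solve 2 (λ z d → con two :* z :* d := z :* d :+ z :* d) refl (fromℤ z) d ⟩
    fromℤ z * d + fromℤ z * d           ≡⟨ cong (_+ fromℤ z * d) (eval-N≡z*D m) ⟨
    eval (N (suc m) z) c + fromℤ z * d  ≡⟨ eval-D-suc (suc m) z c ⟨
    eval (D (suc (suc m)) z) c          ≡⟨ e ⟩
    0ℚ                                  ∎)
    where d = eval (D (suc m) z) c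

  padé : ∀ n → IsPadé n c s (Q (2 ℕ.* n ℕ.+ 1) z)
  padé n = record
    { num-degree = λ k n<k → trans (coeff-N m z k) (term-beyond z (m<2k n<k))
    ; den-degree = λ k n<k → trans (coeff-D m z k) (term-beyond z (ℕ.<-trans (m<2k n<k) (2k<2k+1 k)))
    ; den≢0      = den≢0
    ; vanish     = λ k k<m → trans (cong (λ u → s k - u)
        (quot-unique m (P m) (R m) s {{polyTaylor-nonZero c (D m z) den≢0}} (√-taylor-⊛-D m) k k<m)) (ℚ.+-inverseʳ (s k))
    }
    where
    m = 2 ℕ.* n ℕ.+ 1
    2k<2k+1 : ∀ k → 2 ℕ.* k ℕ.< 2 ℕ.* k ℕ.+ 1
    2k<2k+1 k = ℕ.m<m+n (2 ℕ.* k) (s≤s z≤n)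
    -- 2n + 1 < 2(n + 1) ≤ 2k: this bounds both degrees by n.
    m<2k : ∀ {k} → n ℕ.< k → m ℕ.< 2 ℕ.* k
    m<2k {k} n<k = ℕ.≤-trans (ℕ.≤-reflexive (sym (2*[1+k]≡1+[2*k+1] n))) (ℕ.*-monoʳ-≤ 2 n<k)
    den≢0 : eval (D m z) c ≢ 0ℚ
    den≢0 = subst (λ j → eval (D j z) c ≢ 0ℚ) (ℕ.+-comm 1 (2 ℕ.* n)) (eval-D≢0 (2 ℕ.* n))

-- Newton's method

0<p*p+d : ∀ p {d} → 0 ℕ.< d → 0ℚ ℚ.< p * p + fromℤ (+ d)
0<p*p+d p {suc d} _ = ℚ.+-mono-≤-< (0≤p*p p) (ℚ.positive⁻¹ (fromℤ (+ suc d)))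

module _ (d : ℕ) (0<d : 0 ℕ.< d) (z : ℤ) where

  private
    x₀ = fromℤ (+ d)
    Nₙ Dₙ : ℕ → ℚ
    Nₙ n = eval (N (2 ℕ.^ n) z) x₀
    Dₙ n = eval (D (2 ℕ.^ n) z) x₀

  -- The induction invariant. `D≢0` makes the ratio defined at this stage; `N≢0` makes x nonzero and
  -- hence the next Newton step possible.
  record Convergent (n : ℕ) : Set where
    field
      x        : ℚ
      newton≡x : newton d z n ≡ just x
      x*D≡N    : x * Dₙ n ≡ Nₙ n
      N≢0      : Nₙ n ≢ 0ℚ
      D≢0      : Dₙ n ≢ 0ℚ

  convergent : z ≢ + 0 → ∀ n → Convergent n
  convergent z≢0 zero = record
    { x = fromℤ z
    ; newton≡x = refl
    ; x*D≡N = trans (cong (fromℤ z *_) D₁) (sym N₁)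
    ; N≢0 = λ e → fromℤ≢0 z≢0 (trans (sym (trans N₁ (ℚ.*-identityʳ (fromℤ z)))) e)
    ; D≢0 = λ e → fromℤ≢0 {+ 1} (λ ()) (trans (sym D₁) e)
    }
    where
    D₁ : Dₙ 0 ≡ 1ℚ
    D₁ = eval-D-1 z x₀
    N₁ : Nₙ 0 ≡ fromℤ z * 1ℚ
    N₁ = trans (eval-N-1 z x₀) (sym (ℚ.*-identityʳ (fromℤ z)))
  convergent z≢0 (suc n) = record
    { x = w
    ; newton≡x = trans (cong (_>>= λ x → (x * x + x₀) /? (two * x)) newton≡x) (/?-unique (two * x) 2x≢0 w*2x)
    ; x*D≡N = w*D
    ; N≢0 = λ e → *≢0 num≢0 (*≢0 D≢0 D≢0) (trans (sym N-step) e)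
    ; D≢0 = λ e → *≢0 (fromℤ≢0 {+ 2} λ ()) (*≢0 N≢0 D≢0) (trans (sym D-step) e)
    }
    where
    open Convergent (convergent z≢0 n)
    D² = Dₙ n * Dₙ n
    x≢0 : x ≢ 0ℚ
    x≢0 x≡0 = N≢0 (trans (sym x*D≡N) (trans (cong (_* Dₙ n) x≡0) (ℚ.*-zeroˡ (Dₙ n))))
    2x≢0 : two * x ≢ 0ℚ
    2x≢0 = *≢0 (fromℤ≢0 {+ 2} λ ()) x≢0
    -- A square plus the positive number d is positive; this keeps the next numerator nonzero.
    num≢0 : x * x + x₀ ≢ 0ℚ
    num≢0 e = ℚ.<⇒≢ (0<p*p+d x 0<d) (sym e)
    w : ℚ
    w = ((x * x + x₀) ÷ (two * x)) {{ℚ.≢-nonZero 2x≢0}}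
    w*2x : w * (two * x) ≡ x * x + x₀
    w*2x = ÷-* (x * x + x₀) (two * x) {{ℚ.≢-nonZero 2x≢0}}
    N-step : Nₙ (suc n) ≡ (x * x + x₀) * D²
    N-step = begin
      Nₙ (suc n)                                   ≡⟨ eval-N-double (2 ℕ.^ n) z x₀ ⟩
      Nₙ n * Nₙ n + x₀ * D²                        ≡⟨ cong (λ u → u * u + x₀ * D²) x*D≡N ⟨
      x * Dₙ n * (x * Dₙ n) + x₀ * D²
        ≡⟨ solve 3 (λ x d D → x :* D :* (x :* D) :+ d :* (D :* D) := (x :* x :+ d) :* (D :* D)) refl x x₀ (Dₙ n) ⟩
      (x * x + x₀) * D²                            ∎
    D-step : Dₙ (suc n) ≡ two * (Nₙ n * Dₙ n)
    D-step = eval-D-double (2 ℕ.^ n) z x₀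
    w*D : w * Dₙ (suc n) ≡ Nₙ (suc n)
    w*D = begin
      w * Dₙ (suc n)                      ≡⟨ cong (w *_) D-step ⟩
      w * (two * (Nₙ n * Dₙ n))           ≡⟨ cong (λ u → w * (two * (u * Dₙ n))) x*D≡N ⟨
      w * (two * (x * Dₙ n * Dₙ n))
        ≡⟨ solve 4 (λ w t x D → w :* (t :* (x :* D :* D)) := w :* (t :* x) :* (D :* D)) refl w two x (Dₙ n) ⟩
      w * (two * x) * D²                  ≡⟨ cong (_* D²) w*2x ⟩
      (x * x + x₀) * D²                   ≡⟨ N-step ⟨
      Nₙ (suc n)                          ∎

newton-0 : ∀ d n → newton d (+ 0) (suc n) ≡ nothing
newton-0 d zero    = refl
newton-0 d (suc n) = cong (_>>= λ x → (x * x + fromℤ (+ d)) /? (two * x)) (newton-0 d n)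

-- For z = 0 an even power of √x has no irrational part. Doubling starts from N₁ = 0 and from then
-- on carries D = 0 along.
eval-D-0 : ∀ n x → eval (D (2 ℕ.^ suc n) (+ 0)) x ≡ 0ℚ
eval-D-0 n x = trans (eval-D-double (2 ℕ.^ n) (+ 0) x) (lemma n)
  where
  lemma : ∀ n → two * (eval (N (2 ℕ.^ n) (+ 0)) x * eval (D (2 ℕ.^ n) (+ 0)) x) ≡ 0ℚ
  lemma zero    = trans (cong (λ u → two * (u * eval (D 1 (+ 0)) x)) (eval-N-1 (+ 0) x))
    (solve 1 (λ u → con two :* (con 0ℚ :* u) := con 0ℚ) refl (eval (D 1 (+ 0)) x))
  lemma (suc n) = trans (cong (λ u → two * (eval (N (2 ℕ.^ suc n) (+ 0)) x * u)) (eval-D-0 n x))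
    (solve 1 (λ u → con two :* (u :* con 0ℚ) := con 0ℚ) refl (eval (N (2 ℕ.^ suc n) (+ 0)) x))

-- The case z = 0 is separate: at n = 0 both sides are 0, and afterwards both are `nothing`, through
-- a zero denominator and through division by 2 · 0.
Q-newton : ∀ d → 0 ℕ.< d → ∀ z n → evalRatio (Q (2 ℕ.^ n) z) (fromℤ (+ d)) ≡ newton d z n
Q-newton d 0<d z n with z ℤ.≟ + 0
... | no z≢0 = trans (/?-unique _ D≢0 x*D≡N) (sym newton≡x)
  where open Convergent (convergent d 0<d z z≢0 n)
Q-newton d 0<d _ zero    | yes refl = /?-unique {w = 0ℚ} _ D≢0 x*D≡N
  where
  D≢0 : eval (D 1 (+ 0)) (fromℤ (+ d)) ≢ 0ℚ
  D≢0 e = fromℤ≢0 {+ 1} (λ ()) (trans (sym (eval-D-1 (+ 0) (fromℤ (+ d)))) e)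
  x*D≡N : 0ℚ * eval (D 1 (+ 0)) (fromℤ (+ d)) ≡ eval (N 1 (+ 0)) (fromℤ (+ d))
  x*D≡N = trans (ℚ.*-zeroˡ (eval (D 1 (+ 0)) (fromℤ (+ d)))) (sym (eval-N-1 (+ 0) (fromℤ (+ d))))
Q-newton d 0<d _ (suc n) | yes refl =
  trans (cong (eval (N (2 ℕ.^ suc n) (+ 0)) (fromℤ (+ d)) /?_) (eval-D-0 n (fromℤ (+ d)))) (sym (newton-0 d n))

-- An equality in `Maybe ℚ` could hold between two undefined sides; for z ≠ 0 this rules that out.
newton-defined : ∀ d → 0 ℕ.< d → ∀ z → z ≢ + 0 → ∀ n → Is-just (newton d z n)
newton-defined d 0<d z z≢0 n = subst Is-just (sym newton≡x) (just tt)
  where open Convergent (convergent d 0<d z z≢0 n)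

theorem2 : (d : ℕ) → 0 ℕ.< d → ¬ (∃ λ k → d ≡ k ℕ.* k) → (z : ℤ) →
    ((n : ℕ) → evalRatio (Q (2 ℕ.^ n) z) (fromℤ (+ d)) ≡ newton d z n)
    × (.{{_ : ℤ.NonZero z}} → (n : ℕ) → Is-just (newton d z n))
    × (.{{_ : ℤ.NonZero z}} → (n : ℕ) →
    IsPadé n (fromℤ (z ℤ.* z)) (√-taylor (fromℤ z) {{fromℤ-nonZero z}}) (Q (2 ℕ.* n ℕ.+ 1) z))
theorem2 d 0<d _ z =
    Q-newton d 0<d z
  , (λ {{_}} → newton-defined d 0<d z λ z≡0 → nonZero⇒≢0 (fromℤ z) {{fromℤ-nonZero z}} (cong fromℤ z≡0))
  -- The centre is stated as the image of the integer z², whereas the argument uses the square of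
  -- the image of z.
  , λ n → subst (λ c → IsPadé n c (√-taylor (fromℤ z) {{fromℤ-nonZero z}}) (Q (2 ℕ.* n ℕ.+ 1) z))
      (sym (fromℤ-homo-* z z)) (padé z {{fromℤ-nonZero z}} n)
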